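{- For every fixed $c\in[1,3)$, $R_k^{\mathbb R}(c)$ grows exponentially in $k$. At the endpoint, $R_k^{\mathbb R}(3)\ge2k-1$.
   Context: Online metric matching with action predictions on the real line. There are $k$ labelled servers $S$ at fixed points of $\mathbb R$ (labels stay distinct even if locations coincide), known in advance. Requests $r_1,\dots,r_k\in\mathbb R$ arrive one by one; request $r_t$ arrives together with a predicted server $p_t\in S$, visible before the algorithm acts. Each request must be matched immediately and irrevocably to a currently free server $w$, at cost $|r_t-w|$. $\mathrm{cost}$ is the total cost of the algorithm, and $\mathrm{OPT}$ is the minimum cost of an offline perfect matching of requests to servers. A prediction sequence is perfect if some offline optimal matching $M^*$ has $p_t=M^*(r_t)$ for every $t$. A deterministic algorithm is $c$-consistent if $\mathrm{cost}\le c\cdot\mathrm{OPT}$ on every instance with a perfect prediction sequence, and $r$-robust if $\mathrm{cost}\le r\cdot\mathrm{OPT}$ on every instance, with arbitrary predictions (when $\mathrm{OPT}=0$ both require cost $0$). $R_k^{\mathbb R}(c)$ is the infimum of $r$ over deterministic algorithms for $k$ servers on the real line (which must handle every placement of the $k$ servers on $\mathbb R$) that are $c$-consistent and $r$-robust. -}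

module Defs where

open import Data.Nat as ℕ using (ℕ; zero; suc)
import Data.Nat.Properties as ℕP
open import Data.Integer as ℤ using ()
open import Data.Rational as ℚ using (ℚ; 0ℚ; 1ℚ; ½)
import Data.Rational.Properties as ℚP
open import Data.Rational.Solver using (module +-*-Solver)
open import Data.Fin using (Fin; Fin′; inject!)
open import Data.Fin.Permutation using (Permutation′; _⟨$⟩ʳ_)
open import Data.Product using (_×_; _,_; Σ-syntax; ∃-syntax)
open import Data.Sum using (inj₁; inj₂)
open import Data.Vec.Functional using (foldr)
open import Function using (_∘_)
open import Function.Definitions using (Injective)
open import Relation.Binary.PropositionalEquality

------------------------------------------------------------------------
-- Rational estimates used to close Cauchy sequences under the operations

private

  half-+ : ∀ ε → ½ ℚ.* ε ℚ.+ ½ ℚ.* ε ≡ ε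
  half-+ ε = trans (sym (ℚP.*-distribʳ-+ ε ½ ½)) (ℚP.*-identityˡ ε)

  *-pos : ∀ {p q} → 0ℚ ℚ.< p → 0ℚ ℚ.< q → 0ℚ ℚ.< p ℚ.* q
  *-pos {p} {q} 0<p 0<q =
    subst (ℚ._< p ℚ.* q) (ℚP.*-zeroʳ p)
      (ℚP.*-monoʳ-<-pos p {{ℚ.positive 0<p}} 0<q)

  half-pos : ∀ {ε} → 0ℚ ℚ.< ε → 0ℚ ℚ.< ½ ℚ.* ε
  half-pos = *-pos (ℚP.positive⁻¹ ½)

  dist-self : ∀ p → ℚ.∣ p ℚ.- p ∣ ≡ 0ℚ
  dist-self p = cong ℚ.∣_∣ (ℚP.+-inverseʳ p)

  dist-sym : ∀ p q → ℚ.∣ p ℚ.- q ∣ ≡ ℚ.∣ q ℚ.- p ∣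
  dist-sym p q = trans
    (cong ℚ.∣_∣ (solve 2 (λ a b → a :- b := :- (b :- a)) refl p q))
    (ℚP.∣-p∣≡∣p∣ (q ℚ.- p))
    where open +-*-Solver

  p≤∣p∣ : ∀ p → p ℚ.≤ ℚ.∣ p ∣
  p≤∣p∣ p with ℚP.≤-total 0ℚ p
  ... | inj₁ 0≤p = ℚP.≤-reflexive (sym (ℚP.0≤p⇒∣p∣≡p 0≤p))
  ... | inj₂ p≤0 = ℚP.≤-trans p≤0 (ℚP.0≤∣p∣ p)

  abs-bound : ∀ p q → ℚ.∣ p ∣ ℚ.≤ ℚ.∣ q ∣ ℚ.+ ℚ.∣ p ℚ.- q ∣
  abs-bound p q = subst (λ h → ℚ.∣ h ∣ ℚ.≤ ℚ.∣ q ∣ ℚ.+ ℚ.∣ p ℚ.- q ∣)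
    (solve 2 (λ a b → b :+ (a :- b) := a) refl p q)
    (ℚP.∣p+q∣≤∣p∣+∣q∣ q (p ℚ.- q))
    where open +-*-Solver

  abs-diff : ∀ p q → ℚ.∣ p ∣ ℚ.- ℚ.∣ q ∣ ℚ.≤ ℚ.∣ p ℚ.- q ∣
  abs-diff p q = subst (ℚ.∣ p ∣ ℚ.- ℚ.∣ q ∣ ℚ.≤_)
    (solve 2 (λ b d → (b :+ d) :- b := d) refl ℚ.∣ q ∣ ℚ.∣ p ℚ.- q ∣)
    (ℚP.+-monoˡ-≤ (ℚ.- ℚ.∣ q ∣) (abs-bound p q))
    where open +-*-Solver

  abs-abs-diff : ∀ p q → ℚ.∣ ℚ.∣ p ∣ ℚ.- ℚ.∣ q ∣ ∣ ℚ.≤ ℚ.∣ p ℚ.- q ∣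
  abs-abs-diff p q with ℚP.∣p∣≡p∨∣p∣≡-p (ℚ.∣ p ∣ ℚ.- ℚ.∣ q ∣)
  ... | inj₁ e = subst (ℚ._≤ ℚ.∣ p ℚ.- q ∣) (sym e) (abs-diff p q)
  ... | inj₂ e = subst₂ ℚ._≤_
    (trans (solve 2 (λ a b → b :- a := :- (a :- b)) refl ℚ.∣ p ∣ ℚ.∣ q ∣) (sym e))
    (dist-sym q p)
    (abs-diff q p)
    where open +-*-Solver

  *-bound : ∀ {a b B δ} → 0ℚ ℚ.< B → ℚ.∣ a ∣ ℚ.≤ B → ℚ.∣ b ∣ ℚ.< δ →
            ℚ.∣ a ℚ.* b ∣ ℚ.< B ℚ.* δ
  *-bound {a} {b} {B} {δ} 0<B a≤B b<δ = ℚP.≤-<-trans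
    (ℚP.≤-trans (ℚP.≤-reflexive (ℚP.∣p*q∣≡∣p∣*∣q∣ a b))
      (ℚP.*-monoʳ-≤-nonNeg ℚ.∣ b ∣ {{ℚP.∣-∣-nonNeg b}} a≤B))
    (ℚP.*-monoʳ-<-pos B {{ℚ.positive 0<B}} b<δ)

------------------------------------------------------------------------
-- The real numbers: Cauchy sequences of rationals, compared up to _≃_

Cauchy : (ℕ → ℚ) → Set
Cauchy s = ∀ ε → 0ℚ ℚ.< ε →
  ∃[ N ] (∀ m n → N ℕ.≤ m → N ℕ.≤ n → ℚ.∣ s m ℚ.- s n ∣ ℚ.< ε)

record ℝ : Set where
  constructor mkℝ
  field
    seq    : ℕ → ℚ
    cauchy : Cauchy seq

open ℝ public

infix 4 _≃_ _≤_ _<_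

_≃_ : ℝ → ℝ → Set
x ≃ y = ∀ ε → 0ℚ ℚ.< ε →
  ∃[ N ] (∀ n → N ℕ.≤ n → ℚ.∣ seq x n ℚ.- seq y n ∣ ℚ.< ε)

_≤_ : ℝ → ℝ → Set
x ≤ y = ∀ ε → 0ℚ ℚ.< ε →
  ∃[ N ] (∀ n → N ℕ.≤ n → seq x n ℚ.≤ seq y n ℚ.+ ε)

-- A uniform rational gap is required: termwise strictness alone would
-- not be strictness of the limits.
_<_ : ℝ → ℝ → Set
x < y = Σ[ ε ∈ ℚ ] (0ℚ ℚ.< ε ×
  ∃[ N ] (∀ n → N ℕ.≤ n → seq x n ℚ.+ ε ℚ.≤ seq y n))

private

  eventually-bounded : ∀ {s} → Cauchy s →
    Σ[ B ∈ ℚ ] (0ℚ ℚ.< B × ∃[ N ] (∀ n → N ℕ.≤ n → ℚ.∣ s n ∣ ℚ.≤ B))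
  eventually-bounded {s} cs with cs 1ℚ (ℚP.positive⁻¹ 1ℚ)
  ... | N , h =
    ℚ.∣ s N ∣ ℚ.+ 1ℚ ,
    ℚP.+-mono-≤-< (ℚP.0≤∣p∣ (s N)) (ℚP.positive⁻¹ 1ℚ) ,
    N , λ n le → ℚP.≤-trans (abs-bound (s n) (s N))
      (ℚP.+-monoʳ-≤ ℚ.∣ s N ∣ (ℚP.<⇒≤ (h n N le ℕP.≤-refl)))

  product-diff : ∀ a b c d →
    a ℚ.* b ℚ.- c ℚ.* d ≡ a ℚ.* (b ℚ.- d) ℚ.+ d ℚ.* (a ℚ.- c)
  product-diff = solve 4 (λ a b c d →
      a :* b :- c :* d := a :* (b :- d) :+ d :* (a :- c)) refl
    where open +-*-Solver

  product-close : ∀ a b c d {B C δ γ ε} → 0ℚ ℚ.< B → 0ℚ ℚ.< C →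
    B ℚ.* δ ≡ ½ ℚ.* ε → C ℚ.* γ ≡ ½ ℚ.* ε →
    ℚ.∣ a ∣ ℚ.≤ B → ℚ.∣ d ∣ ℚ.≤ C →
    ℚ.∣ b ℚ.- d ∣ ℚ.< δ → ℚ.∣ a ℚ.- c ∣ ℚ.< γ →
    ℚ.∣ a ℚ.* b ℚ.- c ℚ.* d ∣ ℚ.< ε
  product-close a b c d {B} {C} {δ} {γ} {ε} 0<B 0<C Bδ Cγ a≤B d≤C b-d<δ a-c<γ =
    begin-strict
    ℚ.∣ a ℚ.* b ℚ.- c ℚ.* d ∣
      ≡⟨ cong ℚ.∣_∣ (product-diff a b c d) ⟩
    ℚ.∣ a ℚ.* (b ℚ.- d) ℚ.+ d ℚ.* (a ℚ.- c) ∣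
      ≤⟨ ℚP.∣p+q∣≤∣p∣+∣q∣ (a ℚ.* (b ℚ.- d)) (d ℚ.* (a ℚ.- c)) ⟩
    ℚ.∣ a ℚ.* (b ℚ.- d) ∣ ℚ.+ ℚ.∣ d ℚ.* (a ℚ.- c) ∣
      <⟨ ℚP.+-mono-<
           (*-bound {a} {b ℚ.- d} {B} {δ} 0<B a≤B b-d<δ)
           (*-bound {d} {a ℚ.- c} {C} {γ} 0<C d≤C a-c<γ) ⟩
    B ℚ.* δ ℚ.+ C ℚ.* γ
      ≡⟨ cong₂ ℚ._+_ Bδ Cγ ⟩
    ½ ℚ.* ε ℚ.+ ½ ℚ.* ε
      ≡⟨ half-+ ε ⟩
    ε ∎
    where open ℚP.≤-Reasoning

  -- A tolerance δ with B δ = ε / 2.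
  tolerance : ∀ {B ε} → 0ℚ ℚ.< B → 0ℚ ℚ.< ε →
              Σ[ δ ∈ ℚ ] (0ℚ ℚ.< δ × B ℚ.* δ ≡ ½ ℚ.* ε)
  tolerance {B} {ε} 0<B 0<ε =
    B⁻¹ ℚ.* (½ ℚ.* ε) ,
    *-pos (ℚP.positive⁻¹ B⁻¹ {{ℚP.1/pos⇒pos B}}) (half-pos 0<ε) ,
    trans (sym (ℚP.*-assoc B B⁻¹ (½ ℚ.* ε)))
      (trans (cong (ℚ._* (½ ℚ.* ε)) (ℚP.*-inverseʳ B))
        (ℚP.*-identityˡ (½ ℚ.* ε)))
    where
    instance
      B-pos : ℚ.Positive B
      B-pos = ℚ.positive 0<B
      B-nonZero : ℚ.NonZero B
      B-nonZero = ℚP.pos⇒nonZero B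
    B⁻¹ = ℚ.1/ B

private abstract

  const-cauchy : ∀ q → Cauchy (λ _ → q)
  const-cauchy q ε 0<ε =
    0 , λ _ _ _ _ → subst (ℚ._< ε) (sym (dist-self q)) 0<ε

  +-cauchy : ∀ s t → Cauchy s → Cauchy t → Cauchy (λ n → s n ℚ.+ t n)
  +-cauchy s t cs ct ε 0<ε
    with cs (½ ℚ.* ε) (half-pos 0<ε) | ct (½ ℚ.* ε) (half-pos 0<ε)
  ... | N , hs | M , ht = N ℕ.⊔ M , λ m n le le′ → begin-strict
    ℚ.∣ (s m ℚ.+ t m) ℚ.- (s n ℚ.+ t n) ∣
      ≡⟨ cong ℚ.∣_∣ (solve 4 (λ a b c d → (a :+ b) :- (c :+ d) := (a :- c) :+ (b :- d))
           refl (s m) (t m) (s n) (t n)) ⟩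
    ℚ.∣ (s m ℚ.- s n) ℚ.+ (t m ℚ.- t n) ∣
      ≤⟨ ℚP.∣p+q∣≤∣p∣+∣q∣ (s m ℚ.- s n) (t m ℚ.- t n) ⟩
    ℚ.∣ s m ℚ.- s n ∣ ℚ.+ ℚ.∣ t m ℚ.- t n ∣
      <⟨ ℚP.+-mono-<
           (hs m n (ℕP.m⊔n≤o⇒m≤o N M le) (ℕP.m⊔n≤o⇒m≤o N M le′))
           (ht m n (ℕP.m⊔n≤o⇒n≤o N M le) (ℕP.m⊔n≤o⇒n≤o N M le′)) ⟩
    ½ ℚ.* ε ℚ.+ ½ ℚ.* ε
      ≡⟨ half-+ ε ⟩
    ε ∎
    where
    open +-*-Solver
    open ℚP.≤-Reasoning

  neg-cauchy : ∀ s → Cauchy s → Cauchy (λ n → ℚ.- s n)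
  neg-cauchy s cs ε 0<ε with cs ε 0<ε
  ... | N , h = N , λ m n le le′ →
    subst (ℚ._< ε)
      (cong ℚ.∣_∣ (solve 2 (λ a b → b :- a := :- a :- :- b) refl (s m) (s n)))
      (h n m le′ le)
    where open +-*-Solver

  abs-cauchy : ∀ s → Cauchy s → Cauchy (λ n → ℚ.∣ s n ∣)
  abs-cauchy s cs ε 0<ε with cs ε 0<ε
  ... | N , h = N , λ m n le le′ →
    ℚP.≤-<-trans (abs-abs-diff (s m) (s n)) (h m n le le′)

  *-cauchy : ∀ s t → Cauchy s → Cauchy t → Cauchy (λ n → s n ℚ.* t n)
  *-cauchy s t cs ct ε 0<ε =
    let B , 0<B , N₁ , hB = eventually-bounded cs
        C , 0<C , N₂ , hC = eventually-bounded ct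
        δ , 0<δ , Bδ      = tolerance {B} {ε} 0<B 0<ε
        γ , 0<γ , Cγ      = tolerance {C} {ε} 0<C 0<ε
        N₃ , ht           = ct δ 0<δ
        N₄ , hs           = cs γ 0<γ
    in close B C δ γ N₁ N₂ N₃ N₄ 0<B 0<C Bδ Cγ hB hC ht hs
    where
    close : ∀ B C δ γ N₁ N₂ N₃ N₄ → 0ℚ ℚ.< B → 0ℚ ℚ.< C →
      B ℚ.* δ ≡ ½ ℚ.* ε → C ℚ.* γ ≡ ½ ℚ.* ε →
      (∀ n → N₁ ℕ.≤ n → ℚ.∣ s n ∣ ℚ.≤ B) →
      (∀ n → N₂ ℕ.≤ n → ℚ.∣ t n ∣ ℚ.≤ C) →
      (∀ m n → N₃ ℕ.≤ m → N₃ ℕ.≤ n → ℚ.∣ t m ℚ.- t n ∣ ℚ.< δ) →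
      (∀ m n → N₄ ℕ.≤ m → N₄ ℕ.≤ n → ℚ.∣ s m ℚ.- s n ∣ ℚ.< γ) →
      ∃[ N ] (∀ m n → N ℕ.≤ m → N ℕ.≤ n →
        ℚ.∣ s m ℚ.* t m ℚ.- s n ℚ.* t n ∣ ℚ.< ε)
    close B C δ γ N₁ N₂ N₃ N₄ 0<B 0<C Bδ Cγ hB hC ht hs =
      (N₁ ℕ.⊔ N₂) ℕ.⊔ (N₃ ℕ.⊔ N₄) , λ m n le le′ →
      let p  = ℕP.m⊔n≤o⇒m≤o (N₁ ℕ.⊔ N₂) (N₃ ℕ.⊔ N₄) le
          p′ = ℕP.m⊔n≤o⇒m≤o (N₁ ℕ.⊔ N₂) (N₃ ℕ.⊔ N₄) le′
          q  = ℕP.m⊔n≤o⇒n≤o (N₁ ℕ.⊔ N₂) (N₃ ℕ.⊔ N₄) le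
          q′ = ℕP.m⊔n≤o⇒n≤o (N₁ ℕ.⊔ N₂) (N₃ ℕ.⊔ N₄) le′
      in product-close (s m) (t m) (s n) (t n) {B} {C} {δ} {γ} {ε} 0<B 0<C Bδ Cγ
           (hB m (ℕP.m⊔n≤o⇒m≤o N₁ N₂ p))
           (hC n (ℕP.m⊔n≤o⇒n≤o N₁ N₂ p′))
           (ht m n (ℕP.m⊔n≤o⇒m≤o N₃ N₄ q) (ℕP.m⊔n≤o⇒m≤o N₃ N₄ q′))
           (hs m n (ℕP.m⊔n≤o⇒n≤o N₃ N₄ q) (ℕP.m⊔n≤o⇒n≤o N₃ N₄ q′))

infixl 6 _+_ _-_
infixl 7 _*_
infixr 8 _^_

fromℚ : ℚ → ℝ
fromℚ q = mkℝ (λ _ → q) (const-cauchy q)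

fromℕ : ℕ → ℝ
fromℕ n = fromℚ (ℤ.+ n ℚ./ 1)

0ℝ 1ℝ : ℝ
0ℝ = fromℚ 0ℚ
1ℝ = fromℚ 1ℚ

_+_ : ℝ → ℝ → ℝ
x + y = mkℝ (λ n → seq x n ℚ.+ seq y n) (+-cauchy (seq x) (seq y) (cauchy x) (cauchy y))

-_ : ℝ → ℝ
- x = mkℝ (λ n → ℚ.- seq x n) (neg-cauchy (seq x) (cauchy x))

_-_ : ℝ → ℝ → ℝ
x - y = x + (- y)

_*_ : ℝ → ℝ → ℝ
x * y = mkℝ (λ n → seq x n ℚ.* seq y n) (*-cauchy (seq x) (seq y) (cauchy x) (cauchy y))

∣_∣ : ℝ → ℝ
∣ x ∣ = mkℝ (λ n → ℚ.∣ seq x n ∣) (abs-cauchy (seq x) (cauchy x))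

_^_ : ℝ → ℕ → ℝ
x ^ zero  = 1ℝ
x ^ suc n = x * x ^ n

-- L ≤inf X says L ≤ inf X, the infimum being taken in [-∞ , +∞] with
-- inf ∅ = +∞: a lower bound of X is exactly an L with L ≤ inf X.
infix 4 _≤inf_

_≤inf_ : ℝ → (ℝ → Set) → Set
L ≤inf X = ∀ r → X r → L ≤ r

------------------------------------------------------------------------
-- Metric matching on the line with action predictions

-- Servers are labelled by Fin k and requests are indexed by arrival time,
-- so distinct servers may share a location.
record Instance (k : ℕ) : Set where
  constructor mkInstance
  field
    servers     : Fin k → ℝ
    requests    : Fin k → ℝ
    predictions : Fin k → Fin k

open Instance public

cost : ∀ {k} → Instance k → (Fin k → Fin k) → ℝ
cost I f = foldr _+_ 0ℝ (λ t → ∣ requests I t - servers I (f t) ∣)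

Optimal : ∀ {k} → Instance k → Permutation′ k → Set
Optimal I M = ∀ M′ → cost I (M ⟨$⟩ʳ_) ≤ cost I (M′ ⟨$⟩ʳ_)

-- OPT is a relation because a minimiser cannot be computed from real data.
IsOPT : ∀ {k} → Instance k → ℝ → Set
IsOPT I v = ∃[ M ] (Optimal I M × v ≃ cost I (M ⟨$⟩ʳ_))

PerfectPredictions : ∀ {k} → Instance k → Set
PerfectPredictions I = ∃[ M ] (Optimal I M × (∀ t → predictions I t ≡ M ⟨$⟩ʳ t))

-- At time t an algorithm sees the servers and, for the times 0, …, t
-- (that is, Fin′ (suc t)), the requests and predictions.
Strategy : ℕ → Set
Strategy k = (servers : Fin k → ℝ) (t : Fin k)
             (requests : Fin′ (Fin.suc t) → ℝ)
             (predictions : Fin′ (Fin.suc t) → Fin k) → Fin k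

run : ∀ {k} → Strategy k → Instance k → Fin k → Fin k
run σ I t =
  σ (servers I) t (requests I ∘ inject! {i = Fin.suc t}) (predictions I ∘ inject! {i = Fin.suc t})

-- Reals are compared by _≃_ rather than _≡_, so being a function of the
-- real data (not of its Cauchy representatives) is an explicit condition.
record Algorithm (k : ℕ) : Set where
  field
    strategy : Strategy k
    respects : ∀ {s s′ t r r′ p p′} →
               (∀ i → s i ≃ s′ i) → (∀ j → r j ≃ r′ j) → (∀ j → p j ≡ p′ j) →
               strategy s t r p ≡ strategy s′ t r′ p′
    -- No server is used twice, i.e. the chosen server is always free.
    free     : ∀ I → Injective _≡_ _≡_ (run strategy I)

open Algorithm public

algCost : ∀ {k} → Algorithm k → Instance k → ℝ
algCost A I = cost I (run (strategy A) I)

-- For v = 0 the inequalities below force cost 0, as costs are nonnegative.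
Consistent : ∀ {k} → ℝ → Algorithm k → Set
Consistent c A = ∀ I → PerfectPredictions I → ∀ v → IsOPT I v → algCost A I ≤ c * v

Robust : ∀ {k} → ℝ → Algorithm k → Set
Robust r A = ∀ I v → IsOPT I v → algCost A I ≤ r * v

-- R_k(c) is the infimum of Robustness c k.
Robustness : ℝ → ℕ → ℝ → Set
Robustness c k r = Σ[ A ∈ Algorithm k ] (Consistent c A × Robust r A)

-- The growth of k ↦ inf (X k) is at least exponential; no upper bound is
-- imposed, since inf (X k) may be +∞ (for c = 1 and k ≥ 2, R_k(c) is).
GrowsExponentially : (ℕ → ℝ → Set) → Set
GrowsExponentially X =
  Σ[ a ∈ ℝ ] Σ[ b ∈ ℝ ] (0ℝ < a × 1ℝ < b ×
    (∀ k → 1 ℕ.≤ k → a * b ^ k ≤inf X k))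

{-# OPTIONS --safe #-}

-- The adversary puts server 0 at the origin and the others at 1 ≤ d 1 ≤ d 2 ≤ …; the first
-- request is at 1 = d 0, and each later one at the server just used. Call the first unused
-- server on the right the hole: the predictions move the first request to the hole and leave
-- the others at home, up to relaying through servers that were holes before. If server 0 is
-- used while the hole is f + 1, the remaining requests make these predictions perfect, with
-- OPT = d (f + 1) - 1, while the algorithm has gone out to d f, back to the origin, and must
-- still transport to the hole: it pays at least 2 (d f) - 1 + d (f + 1). If d grows slowly
-- enough for this to exceed c OPT, server 0 is used last, at cost at least 2 (d n) - 1, while
-- moving the first request to the origin shows OPT = 1. Slowly enough means d i = (1 + ε/2)^i
-- for c ≤ 3 - ε, and increments just below 1 for c = 3.

module Submission where

open import Defs
open import Data.Nat using (ℕ; zero; suc; z≤n; s≤s)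
import Data.Nat as ℕ
open import Data.Product using (_×_; Σ-syntax; ∃-syntax; _,_; proj₁; proj₂)
import Data.Nat.Properties as ℕP
open import Data.Integer as ℤ using ()
import Data.Integer.Properties as ℤP
open import Data.Rational as ℚ using (ℚ; 0ℚ; 1ℚ; ½)
import Data.Rational.Properties as ℚP
open import Data.Rational.Solver using (module +-*-Solver)
import Data.Rational.Unnormalised as ℚᵘ
import Data.Rational.Unnormalised.Properties as ℚᵘP
open import Data.Fin as Fin using (Fin; zero; suc; toℕ; fromℕ<; inject; inject₁; inject!)
import Data.Fin.Properties as FinP
open import Data.Fin.Permutation using (Permutation′; permutation; _⟨$⟩ʳ_)
open import Data.Fin.Relation.Unary.Top using (view; ‵fromℕ; ‵inject₁)
open import Data.List using (List; []; _∷_)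
open import Data.List.Membership.Propositional using (_∈_; _∉_)
open import Data.List.Relation.Unary.All as All using (All; []; _∷_)
open import Data.List.Relation.Unary.Any using (here; there)
open import Data.List.Relation.Unary.AllPairs using ([]; _∷_)
open import Data.List.Relation.Unary.Unique.Propositional using (Unique)
open import Data.Sum using (_⊎_; inj₁; inj₂)
open import Data.Vec.Functional using (foldr)
open import Algebra.Properties.CommutativeMonoid.Sum ℚP.+-0-commutativeMonoid
  using (sum; sum-init-last; sum-cong-≗; ∑-distrib-+; sum-permute)
open import Function using (_∘_; id)
open import Function.Definitions using (Injective)
open import Relation.Binary.Definitions using (tri<; tri≈; tri>)
open import Relation.Binary.PropositionalEquality
open import Relation.Nullary using (yes; no; contradiction)

-- Rational inequalities, distances and finite sums

-- The equation says d − c = b − a.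
≤-shift : ∀ {a b c d} → a ℚ.≤ b → c ℚ.+ b ≡ d ℚ.+ a → c ℚ.≤ d
≤-shift {a} {b} {c} {d} a≤b eq = begin
  c                  ≡⟨ solve 2 (λ b c → c := c :+ b :- b) refl b c ⟩
  c ℚ.+ b ℚ.- b      ≡⟨ cong (ℚ._- b) eq ⟩
  d ℚ.+ a ℚ.- b      ≤⟨ ℚP.+-monoˡ-≤ (ℚ.- b) (ℚP.+-monoʳ-≤ d a≤b) ⟩
  d ℚ.+ b ℚ.- b      ≡⟨ solve 2 (λ b d → d :+ b :- b := d) refl b d ⟩
  d                  ∎
  where
  open +-*-Solver
  open ℚP.≤-Reasoning

<-shift : ∀ {a b c d} → a ℚ.< b → c ℚ.+ b ≡ d ℚ.+ a → c ℚ.< d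
<-shift {a} {b} {c} {d} a<b eq = begin-strict
  c                  ≡⟨ solve 2 (λ b c → c := c :+ b :- b) refl b c ⟩
  c ℚ.+ b ℚ.- b      ≡⟨ cong (ℚ._- b) eq ⟩
  d ℚ.+ a ℚ.- b      <⟨ ℚP.+-monoˡ-< (ℚ.- b) (ℚP.+-monoʳ-< d a<b) ⟩
  d ℚ.+ b ℚ.- b      ≡⟨ solve 2 (λ b d → d :+ b :- b := d) refl b d ⟩
  d                  ∎
  where
  open +-*-Solver
  open ℚP.≤-Reasoning

dist : ℚ → ℚ → ℚ
dist x y = ℚ.∣ x ℚ.- y ∣

dist-refl : ∀ x → dist x x ≡ 0ℚ
dist-refl x = cong ℚ.∣_∣ (ℚP.+-inverseʳ x)

dist-ordered : ∀ {x y} → x ℚ.≤ y → dist x y ℚ.+ x ≡ y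
dist-ordered {x} {y} x≤y = begin
  dist x y ℚ.+ x    ≡⟨ cong (ℚ._+ x) (ℚP.∣-p∣≡∣p∣ (x ℚ.- y)) ⟨
  ℚ.∣ ℚ.- (x ℚ.- y) ∣ ℚ.+ x
    ≡⟨ cong (λ z → ℚ.∣ z ∣ ℚ.+ x) (solve 2 (λ x y → :- (x :- y) := y :- x) refl x y) ⟩
  ℚ.∣ y ℚ.- x ∣ ℚ.+ x
    ≡⟨ cong (ℚ._+ x) (ℚP.0≤p⇒∣p∣≡p {y ℚ.- x} (≤-shift x≤y
         (solve 2 (λ x y → con 0ℚ :+ y := y :- x :+ x) refl x y))) ⟩
  y ℚ.- x ℚ.+ x     ≡⟨ solve 2 (λ x y → y :- x :+ x := y) refl x y ⟩
  y                 ∎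
  where
  open +-*-Solver
  open ≡-Reasoning

y≤dist+x : ∀ x y → y ℚ.≤ dist x y ℚ.+ x
y≤dist+x x y with ℚP.≤-total x y
... | inj₁ x≤y = ℚP.≤-reflexive (sym (dist-ordered x≤y))
... | inj₂ y≤x = ℚP.≤-trans y≤x
  (≤-shift (ℚP.0≤∣p∣ (x ℚ.- y)) (solve 2 (λ x d → x :+ d := d :+ x :+ con 0ℚ) refl x (dist x y)))
  where open +-*-Solver

x≤dist+y : ∀ x y → x ℚ.≤ dist x y ℚ.+ y
x≤dist+y x y = subst (λ d → x ℚ.≤ d ℚ.+ y)
  (trans (sym (ℚP.∣-p∣≡∣p∣ (y ℚ.- x)))
    (cong ℚ.∣_∣ (solve 2 (λ x y → :- (y :- x) := x :- y) refl x y)))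
  (y≤dist+x y x)
  where open +-*-Solver

≤-limit : ∀ {a b} → (∀ ε → 0ℚ ℚ.< ε → a ℚ.≤ b ℚ.+ ε) → a ℚ.≤ b
≤-limit {a} {b} h with a ℚP.≤? b
... | yes a≤b = a≤b
... | no a≰b with ℚP.<-dense (ℚP.≰⇒> a≰b)
...   | m , b<m , m<a = contradiction
  (ℚP.≤-<-trans
    (h (m ℚ.- b) (<-shift b<m (solve 2 (λ b m → con 0ℚ :+ m := m :- b :+ b) refl b m)))
    (subst (ℚ._< a) (solve 2 (λ b m → m := b :+ (m :- b)) refl b m) m<a))
  (ℚP.<-irrefl refl)
  where open +-*-Solver

sum-mono-≤ : ∀ {k} {f g : Fin k → ℚ} → (∀ t → f t ℚ.≤ g t) → sum f ℚ.≤ sum g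
sum-mono-≤ {zero}  f≤g = ℚP.≤-refl
sum-mono-≤ {suc k} f≤g = ℚP.+-mono-≤ (f≤g zero) (sum-mono-≤ (f≤g ∘ suc))

monotone : ∀ {d : ℕ → ℚ} → (∀ i → d i ℚ.≤ d (suc i)) → ∀ {i j} → i ℕ.≤ j → d i ℚ.≤ d j
monotone {d} step i≤j = go (ℕP.≤⇒≤′ i≤j)
  where
  go : ∀ {i j} → i ℕ.≤′ j → d i ℚ.≤ d j
  go (ℕ.≤′-reflexive refl) = ℚP.≤-refl
  go (ℕ.≤′-step i≤j)       = ℚP.≤-trans (go i≤j) (step _)

-- A missed value `i` could be punched out of the codomain, leaving an injection of `Fin (suc k)`
-- into `Fin k`.
injective⇒surjective : ∀ {k} {f : Fin k → Fin k} → Injective _≡_ _≡_ f → ∀ i → ∃[ t ] f t ≡ i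
injective⇒surjective {suc k} {f} inj i with FinP.any? (λ t → f t FinP.≟ i)
... | yes hit = hit
... | no miss = contradiction
  (FinP.injective⇒≤ {f = λ t → Fin.punchOut (avoid t)}
    (λ {s} {t} eq → inj (FinP.punchOut-injective (avoid s) (avoid t) eq)))
  ℕP.1+n≰n
  where
  avoid : ∀ t → i ≢ f t
  avoid t eq = miss (t , sym eq)

injective⇒permutation : ∀ {k} {f : Fin k → Fin k} → Injective _≡_ _≡_ f →
                        Permutation′ k
injective⇒permutation {f = f} inj =
  permutation f (proj₁ ∘ onto) (proj₂ ∘ onto) (λ t → inj (proj₂ (onto (f t))))
  where onto = injective⇒surjective inj

-- Plays as histories of answers

-- Histories list the latest entry first.
past : ∀ {k} {A : Set} → (Fin k → A) → Fin k → List A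
past w zero              = []
past {suc k} w (suc t) = w (inject₁ t) ∷ past (w ∘ inject₁) t

whole : ∀ {k} {A : Set} → (Fin k → A) → List A
whole {zero}  w = []
whole {suc k} w = w (Fin.fromℕ k) ∷ whole (w ∘ inject₁)

whole-cong : ∀ {k} {A : Set} {w w′ : Fin k → A} → w ≗ w′ → whole w ≡ whole w′
whole-cong {zero}  eq = refl
whole-cong {suc k} eq = cong₂ _∷_ (eq (Fin.fromℕ k)) (whole-cong (eq ∘ inject₁))

module _ {A : Set} where

  past-inject₁ : ∀ {k} (w : Fin (suc k) → A) (t : Fin k) →
                 past w (inject₁ t) ≡ past (w ∘ inject₁) t
  past-inject₁ w zero              = refl
  past-inject₁ {suc k} w (suc t) =
    cong (w (inject₁ (inject₁ t)) ∷_) (past-inject₁ (w ∘ inject₁) t)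

  past-fromℕ : ∀ {k} (w : Fin (suc k) → A) → past w (Fin.fromℕ k) ≡ whole (w ∘ inject₁)
  past-fromℕ {zero}  w = refl
  past-fromℕ {suc k} w = cong (w (inject₁ (Fin.fromℕ k)) ∷_) (past-fromℕ (w ∘ inject₁))

  past-cong : ∀ {k} {w w′ : Fin k → A} (t : Fin k) →
              (∀ s → s Fin.< t → w s ≡ w′ s) → past w t ≡ past w′ t
  past-cong zero              eq = refl
  past-cong {suc k} (suc t) eq = cong₂ _∷_
    (eq (inject₁ t) (s≤s (ℕP.≤-reflexive (FinP.toℕ-inject₁ t))))
    (past-cong t (λ s s<t → eq (inject₁ s)
      (s≤s (ℕP.≤-trans (ℕP.≤-reflexive (FinP.toℕ-inject₁ s)) (ℕP.<⇒≤ s<t)))))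

  ∈-whole⁺ : ∀ {k} (w : Fin k → A) t → w t ∈ whole w
  ∈-whole⁺ {suc k} w t with view t
  ... | ‵fromℕ     = here refl
  ... | ‵inject₁ s = there (∈-whole⁺ (w ∘ inject₁) s)

  ∈-whole⁻ : ∀ {k} (w : Fin k → A) {x} → x ∈ whole w → ∃[ t ] w t ≡ x
  ∈-whole⁻ {suc k} w (here eq)   = Fin.fromℕ k , sym eq
  ∈-whole⁻ {suc k} w (there x∈w) with ∈-whole⁻ (w ∘ inject₁) x∈w
  ... | t , eq = inject₁ t , eq

  injective⇒unique : ∀ {k} {w : Fin k → A} → Injective _≡_ _≡_ w → Unique (whole w)
  injective⇒unique {zero}      inj = []
  injective⇒unique {suc k} {w} inj =
    All.tabulate (λ x∈w eq → let t , eq′ = ∈-whole⁻ (w ∘ inject₁) x∈w in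
      FinP.fromℕ≢inject₁ (inj (trans eq (sym eq′))))
    ∷ injective⇒unique (FinP.inject₁-injective ∘ inj)

  unique⇒injective : ∀ {k} {w : Fin k → A} → Unique (whole w) → Injective _≡_ _≡_ w
  unique⇒injective {suc k} {w} (new ∷ u) {s} {t} eq with view s | view t
  ... | ‵fromℕ      | ‵fromℕ      = refl
  ... | ‵fromℕ      | ‵inject₁ t′ =
    contradiction eq (All.lookup new (∈-whole⁺ (w ∘ inject₁) t′))
  ... | ‵inject₁ s′ | ‵fromℕ      =
    contradiction (sym eq) (All.lookup new (∈-whole⁺ (w ∘ inject₁) s′))
  ... | ‵inject₁ s′ | ‵inject₁ t′ = cong inject₁ (unique⇒injective u eq)

  tally : (List A → A → ℚ) → List A → ℚ
  tally F []      = 0ℚ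
  tally F (b ∷ l) = F l b ℚ.+ tally F l

  -- Costs are sums over time, whereas the adversary looks back at a history; in this form they can
  -- be analysed by induction on the answers.
  sum-past : ∀ (F : List A → A → ℚ) {k} (w : Fin k → A) →
             sum (λ t → F (past w t) (w t)) ≡ tally F (whole w)
  sum-past F {zero}  w = refl
  sum-past F {suc k} w = begin
    sum f                              ≡⟨ sum-init-last f ⟩
    sum (f ∘ inject₁) ℚ.+ f (Fin.fromℕ k)  ≡⟨ ℚP.+-comm (sum (f ∘ inject₁)) (f (Fin.fromℕ k)) ⟩
    f (Fin.fromℕ k) ℚ.+ sum (f ∘ inject₁)
      ≡⟨ cong₂ ℚ._+_ (cong (λ l → F l (w (Fin.fromℕ k))) (past-fromℕ w))
           (trans (sum-cong-≗ (λ t → cong (λ l → F l (w (inject₁ t))) (past-inject₁ w t)))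
             (sum-past F (w ∘ inject₁))) ⟩
    tally F (whole w)                  ∎
    where
    open ≡-Reasoning
    f : Fin (suc k) → ℚ
    f t = F (past w t) (w t)

  -- For a decision rule `G` these are its decisions, each made before the corresponding answer.
  -- Their distinctness makes the rule a permutation.
  trail : ∀ {B : Set} → (List A → B) → List A → List B
  trail G []      = []
  trail G (b ∷ l) = G l ∷ trail G l

  whole-past : ∀ {B : Set} (G : List A → B) {k} (w : Fin k → A) →
               whole (G ∘ past w) ≡ trail G (whole w)
  whole-past G {zero}  w = refl
  whole-past G {suc k} w = cong₂ _∷_ (cong G (past-fromℕ w))
    (trans (whole-cong (λ t → cong G (past-inject₁ w t))) (whole-past G (w ∘ inject₁)))

-- The adversary and its invariants along a history

module Adversary (n : ℕ) (d : ℕ → ℚ) (d-zero : d 0 ≡ 1ℚ)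
                 (d-mono : ∀ {i j} → i ℕ.≤ j → d i ℚ.≤ d j) where

  open +-*-Solver

  Label : Set
  Label = Fin (suc n)

  open import Data.List.Membership.DecPropositional (FinP._≟_ {suc n}) using (_∈?_)

  pos : Label → ℚ
  pos zero    = 0ℚ
  pos (suc i) = d (suc (toℕ i))

  -- Once the right-hand servers are exhausted, server 0 counts as the hole, so that there is always
  -- exactly one.
  data Hole (l : List Label) : Label → Set where
    final : (∀ i → suc i ∈ l) → Hole l zero
    next  : ∀ i → suc i ∉ l → (∀ j → j Fin.< i → suc j ∈ l) → Hole l (suc i)

  findHole : ∀ l → ∃[ h ] Hole l h
  findHole l with FinP.all? (λ i → suc i ∈? l)
  ... | yes all = zero , final all
  ... | no ¬all with FinP.¬∀⟶∃¬-smallest n _ (λ i → suc i ∈? l) ¬all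
  ...   | i , i∉l , below = suc i , next i i∉l λ j j<i →
    subst (λ z → suc z ∈ l)
      (FinP.toℕ-injective (trans (FinP.toℕ-inject (fromℕ< j<i)) (FinP.toℕ-fromℕ< j<i)))
      (below (fromℕ< j<i))

  hole : List Label → Label
  hole l = proj₁ (findHole l)

  hole-spec : ∀ l → Hole l (hole l)
  hole-spec l = proj₂ (findHole l)

  Hole-unique : ∀ {l a b} → Hole l a → Hole l b → a ≡ b
  Hole-unique (final _)          (final _)          = refl
  Hole-unique (final all)        (next i i∉l _)     = contradiction (all i) i∉l
  Hole-unique (next i i∉l _)     (final all)        = contradiction (all i) i∉l
  Hole-unique (next i i∉l below) (next j j∉l below′) with FinP.<-cmp i j
  ... | tri< i<j _ _  = contradiction (below′ i i<j) i∉l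
  ... | tri≈ _ refl _ = refl
  ... | tri> _ _ j<i  = contradiction (below j j<i) j∉l

  hole-stays : ∀ {b} l → b ≢ hole l → hole (b ∷ l) ≡ hole l
  hole-stays {b} l b≢h = Hole-unique (hole-spec (b ∷ l)) (extend (hole-spec l) b≢h)
    where
    extend : ∀ {h} → Hole l h → b ≢ h → Hole (b ∷ l) h
    extend (final all)        b≢h = final (there ∘ all)
    extend (next i i∉l below) b≢h = next i
      (λ { (here eq) → b≢h (sym eq) ; (there i∈l) → i∉l i∈l })
      (λ j j<i → there (below j j<i))

  hole-zero : ∀ l → hole l ≡ zero → ∀ i → suc i ∈ l
  hole-zero l eq with hole l | hole-spec l
  hole-zero l refl | _ | final all = all

  hole-zero-∷ : ∀ {b} l → hole (b ∷ l) ≢ zero → hole l ≢ zero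
  hole-zero-∷ l h≢0 eq =
    h≢0 (Hole-unique (hole-spec (_ ∷ l)) (final (there ∘ hole-zero l eq)))

  hole-fresh : ∀ {c} l → c ∉ l → hole l ∉ l
  hole-fresh {c} l c∉l h∈l with hole l | hole-spec l
  hole-fresh {zero}  l c∉l h∈l | _ | final all    = c∉l h∈l
  hole-fresh {suc i} l c∉l h∈l | _ | final all    = c∉l (all i)
  hole-fresh         l c∉l h∈l | _ | next i i∉l _ = i∉l h∈l

  -- If `b` was the hole, an earlier request was already predicted `b`, so the new one is relayed to
  -- the new hole. After any other answer it is predicted to stay at the server just used.
  aim : List Label → Label
  aim []      = hole []
  aim (b ∷ l) with b FinP.≟ hole l
  ... | yes _ = hole (b ∷ l)
  ... | no  _ = b

  data Aim (b : Label) (l : List Label) : Label → Set where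
    hit  : b ≡ hole l → Aim b l (hole (b ∷ l))
    miss : b ≢ hole l → Aim b l b

  aim-view : ∀ b l → Aim b l (aim (b ∷ l))
  aim-view b l with b FinP.≟ hole l
  ... | yes b≡h = hit b≡h
  ... | no  b≢h = miss b≢h

  -- Once server 0 is used, requests are placed where following the prediction is free.
  site : List Label → ℚ
  site []      = 1ℚ
  site (b ∷ l) with zero ∈? (b ∷ l)
  ... | yes _ = pos (aim (b ∷ l))
  ... | no  _ = pos b

  site-before : ∀ {b l} → zero ∉ b ∷ l → site (b ∷ l) ≡ pos b
  site-before {b} {l} z∉ with zero ∈? (b ∷ l)
  ... | yes z∈ = contradiction z∈ z∉
  ... | no  _  = refl

  site-after : ∀ {l} → zero ∈ l → site l ≡ pos (aim l)
  site-after {b ∷ l} z∈ with zero ∈? (b ∷ l)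
  ... | yes _  = refl
  ... | no  z∉ = contradiction z∈ z∉

  -- The offline matching for the case that server 0 is used last: the first request moves to the
  -- origin and no other request moves.
  home : List Label → Label
  home []      = zero
  home (b ∷ l) = b

  algTotal aimTotal homeTotal positions aims sites : List Label → ℚ
  algTotal  = tally (λ l b → dist (site l) (pos b))
  aimTotal  = tally (λ l _ → dist (site l) (pos (aim l)))
  homeTotal = tally (λ l _ → dist (site l) (pos (home l)))
  positions = tally (λ _ b → pos b)
  aims      = tally (λ l _ → pos (aim l))
  sites     = tally (λ l _ → site l)

  ∈-trail-aim : ∀ b l → All (λ q → q ∈ l ⊎ q ≡ hole l) (trail aim (b ∷ l))
  ∈-trail-aim b []      = inj₂ refl ∷ []
  ∈-trail-aim b (a ∷ l) with aim (a ∷ l) | aim-view a l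
  ... | _ | hit a≡h  = inj₂ refl ∷ All.map
    (λ { (inj₁ q∈l) → inj₁ (there q∈l) ; (inj₂ q≡h) → inj₁ (here (trans q≡h (sym a≡h))) })
    (∈-trail-aim a l)
  ... | _ | miss a≢h = inj₁ (here refl) ∷ All.map
    (λ { (inj₁ q∈l) → inj₁ (there q∈l) ; (inj₂ q≡h) → inj₂ (trans q≡h (sym (hole-stays l a≢h))) })
    (∈-trail-aim a l)

  unique-head : ∀ {a : Label} {l} → Unique (a ∷ l) → a ∉ l
  unique-head (a≢ ∷ _) a∈l = All.lookup a≢ a∈l refl

  trail-aim-unique : ∀ {b} l → Unique (b ∷ l) → Unique (trail aim (b ∷ l))
  trail-aim-unique []      u            = [] ∷ []
  trail-aim-unique (a ∷ l) u@(_ ∷ u′) with aim (a ∷ l) | aim-view a l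
  ... | _ | hit a≡h  = All.map
    (λ { (inj₁ q∈l) refl → hole-fresh (a ∷ l) (unique-head u) (there q∈l)
       ; (inj₂ q≡h) refl → hole-fresh (a ∷ l) (unique-head u) (here (trans q≡h (sym a≡h))) })
    (∈-trail-aim a l) ∷ trail-aim-unique l u′
  ... | _ | miss a≢h = All.map
    (λ { (inj₁ q∈l) refl → unique-head u′ q∈l ; (inj₂ q≡h) refl → a≢h q≡h })
    (∈-trail-aim a l) ∷ trail-aim-unique l u′

  ∈-trail-home : ∀ b l → All (λ q → q ∈ l ⊎ q ≡ zero) (trail home (b ∷ l))
  ∈-trail-home b []      = inj₂ refl ∷ []
  ∈-trail-home b (a ∷ l) = inj₁ (here refl) ∷
    All.map (λ { (inj₁ q∈l) → inj₁ (there q∈l) ; (inj₂ q≡0) → inj₂ q≡0 }) (∈-trail-home a l)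

  trail-home-unique : ∀ {b} l → Unique l → zero ∉ l → Unique (trail home (b ∷ l))
  trail-home-unique []      u          z∉ = [] ∷ []
  trail-home-unique (a ∷ l) u@(_ ∷ u′) z∉ = All.map
    (λ { (inj₁ q∈l) refl → unique-head u q∈l ; (inj₂ q≡0) refl → z∉ (here (sym q≡0)) })
    (∈-trail-home a l) ∷ trail-home-unique {a} l u′ (z∉ ∘ there)

  aims-before : ∀ b l → aims (b ∷ l) ≡ positions l ℚ.+ pos (hole l)
  aims-before b []      = ℚP.+-comm (pos (hole [])) 0ℚ
  aims-before b (a ∷ l) with aim (a ∷ l) | aim-view a l
  ... | _ | hit a≡h  = trans
    (cong (λ z → pos (hole (a ∷ l)) ℚ.+ z)
      (trans (aims-before a l) (cong (λ z → positions l ℚ.+ pos z) (sym a≡h))))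
    (solve 3 (λ h w a → h :+ (w :+ a) := a :+ w :+ h) refl
      (pos (hole (a ∷ l))) (positions l) (pos a))
  ... | _ | miss a≢h = trans
    (cong (pos a ℚ.+_) (aims-before a l))
    (trans (sym (ℚP.+-assoc (pos a) (positions l) (pos (hole l))))
      (cong (λ z → pos a ℚ.+ positions l ℚ.+ pos z) (sym (hole-stays l a≢h))))

  sites-before : ∀ b l → zero ∉ l → sites (b ∷ l) ≡ positions l ℚ.+ 1ℚ
  sites-before b []      z∉ = refl
  sites-before b (a ∷ l) z∉ = trans
    (cong₂ ℚ._+_ (site-before z∉) (sites-before a l (z∉ ∘ there)))
    (sym (ℚP.+-assoc (pos a) (positions l) 1ℚ))

  homeTotal-before : ∀ b l → zero ∉ l → homeTotal (b ∷ l) ≡ 1ℚ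
  homeTotal-before b []      z∉ = refl
  homeTotal-before b (a ∷ l) z∉ = cong₂ ℚ._+_
    (trans (cong (λ z → dist z (pos a)) (site-before z∉)) (dist-refl (pos a)))
    (homeTotal-before a l (z∉ ∘ there))

  -- While server 0 is free, each request starts where the last answer ended, so the play is a walk
  -- from 1 of length `algTotal l`.
  site≤algTotal : ∀ l → zero ∉ l → site l ℚ.≤ algTotal l ℚ.+ 1ℚ
  site≤algTotal []      z∉ = ℚP.≤-refl
  site≤algTotal (b ∷ l) z∉ = ≤-shift
    (ℚP.+-mono-≤ (y≤dist+x (site l) (pos b)) (site≤algTotal l (z∉ ∘ there)))
    (trans (cong (ℚ._+ (dist (site l) (pos b) ℚ.+ site l ℚ.+ (algTotal l ℚ.+ 1ℚ)))
             (site-before {b} {l} z∉))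
      (solve 4 (λ p D s A → p :+ (D :+ s :+ (A :+ con 1ℚ)) := D :+ A :+ con 1ℚ :+ (p :+ s)) refl
        (pos b) (dist (site l) (pos b)) (site l) (algTotal l)))

  1≤d : ∀ i → 1ℚ ℚ.≤ d i
  1≤d i = subst (ℚ._≤ d i) d-zero (d-mono z≤n)

  reach-∷ : ∀ b l → zero ∉ b ∷ l → ∀ {y} → y ℚ.≤ algTotal l ℚ.+ site l ℚ.+ 1ℚ →
            y ℚ.≤ algTotal (b ∷ l) ℚ.+ site (b ∷ l) ℚ.+ 1ℚ
  reach-∷ b l z∉ {y} y≤ = ≤-shift
    (ℚP.+-mono-≤ y≤ (x≤dist+y (site l) (pos b)))
    (trans
      (solve 5 (λ y D s A p → y :+ (A :+ s :+ con 1ℚ :+ (D :+ p))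
                           := D :+ A :+ p :+ con 1ℚ :+ (y :+ s)) refl
        y (dist (site l) (pos b)) (site l) (algTotal l) (pos b))
      (cong (λ z → dist (site l) (pos b) ℚ.+ algTotal l ℚ.+ z ℚ.+ 1ℚ ℚ.+ (y ℚ.+ site l))
        (sym (site-before z∉))))

  -- The walk goes from 1 out to `d (toℕ j)` and back to the current site. The label `zero` stands
  -- here for the start `d 0`, not for server 0 at the origin.
  reach : ∀ l → zero ∉ l → ∀ j → j ≡ zero ⊎ j ∈ l →
          d (toℕ j) ℚ.+ d (toℕ j) ℚ.≤ algTotal l ℚ.+ site l ℚ.+ 1ℚ
  reach []      z∉ j (inj₁ refl) rewrite d-zero = ℚP.≤-refl
  reach (b ∷ l) z∉ j (inj₂ (here refl)) with j
  ... | zero  = contradiction (here refl) z∉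
  ... | suc i = ≤-shift
    (ℚP.+-mono-≤ (y≤dist+x (site l) p) (site≤algTotal l (z∉ ∘ there)))
    (trans
      (solve 4 (λ p D s A → p :+ p :+ (D :+ s :+ (A :+ con 1ℚ))
                         := D :+ A :+ p :+ con 1ℚ :+ (p :+ s)) refl
        p (dist (site l) p) (site l) (algTotal l))
      (cong (λ z → dist (site l) p ℚ.+ algTotal l ℚ.+ z ℚ.+ 1ℚ ℚ.+ (p ℚ.+ site l))
        (sym (site-before z∉))))
    where p = d (suc (toℕ i))
  reach (b ∷ l) z∉ j (inj₁ j≡0)       = reach-∷ b l z∉ (reach l (z∉ ∘ there) j (inj₁ j≡0))
  reach (b ∷ l) z∉ j (inj₂ (there j∈)) = reach-∷ b l z∉ (reach l (z∉ ∘ there) j (inj₂ j∈))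

  hole-advances : ∀ {b} l → b ≡ hole l → zero ∉ b ∷ l → hole (b ∷ l) ≢ zero →
                  pos b ℚ.≤ pos (hole (b ∷ l))
  hole-advances {b} l b≡h z∉ h≢0
    with hole l | hole-spec l | hole (b ∷ l) | hole-spec (b ∷ l)
  ... | _ | final _        | _ | _          = contradiction (here (sym b≡h)) z∉
  ... | _ | next i _ _     | _ | final _    = contradiction refl h≢0
  ... | _ | next i _ below | _ | next j j∉ _ with toℕ i ℕ.≤? toℕ j
  ...   | yes i≤j = subst (λ z → pos z ℚ.≤ _) (sym b≡h) (d-mono (s≤s i≤j))
  ...   | no i≰j  = contradiction (there (below j (ℕP.≰⇒> i≰j))) j∉

  -- The relays run rightwards from 1 through successive holes by `hole-advances`, so their lengths
  -- telescope; the other requests sit on their predicted servers.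
  aimTotal-before : ∀ b l → zero ∉ l → hole l ≢ zero → aimTotal (b ∷ l) ℚ.+ 1ℚ ≡ pos (hole l)
  aimTotal-before b [] z∉ h≢0 with hole [] | hole-spec []
  ... | _ | final _    = contradiction refl h≢0
  ... | _ | next i _ _ = trans (cong (ℚ._+ 1ℚ) (ℚP.+-identityʳ (dist 1ℚ (pos (suc i)))))
    (dist-ordered (1≤d _))
  aimTotal-before b (a ∷ l) z∉ h≢0
    with aimTotal-before a l (z∉ ∘ there) (hole-zero-∷ l h≢0) | aim (a ∷ l) | aim-view a l
  ... | ih | _ | hit a≡h  = begin
    dist (site (a ∷ l)) h′ ℚ.+ aimTotal (a ∷ l) ℚ.+ 1ℚ
      ≡⟨ cong (λ z → dist z h′ ℚ.+ aimTotal (a ∷ l) ℚ.+ 1ℚ) (site-before z∉) ⟩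
    dist (pos a) h′ ℚ.+ aimTotal (a ∷ l) ℚ.+ 1ℚ
      ≡⟨ ℚP.+-assoc (dist (pos a) h′) (aimTotal (a ∷ l)) 1ℚ ⟩
    dist (pos a) h′ ℚ.+ (aimTotal (a ∷ l) ℚ.+ 1ℚ)
      ≡⟨ cong (dist (pos a) h′ ℚ.+_) (trans ih (cong pos (sym a≡h))) ⟩
    dist (pos a) h′ ℚ.+ pos a
      ≡⟨ dist-ordered (hole-advances l a≡h z∉ h≢0) ⟩
    h′ ∎
    where
    open ≡-Reasoning
    h′ = pos (hole (a ∷ l))
  ... | ih | _ | miss a≢h = begin
    dist (site (a ∷ l)) (pos a) ℚ.+ aimTotal (a ∷ l) ℚ.+ 1ℚ
      ≡⟨ cong (λ z → z ℚ.+ aimTotal (a ∷ l) ℚ.+ 1ℚ)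
           (trans (cong (λ z → dist z (pos a)) (site-before z∉)) (dist-refl (pos a))) ⟩
    0ℚ ℚ.+ aimTotal (a ∷ l) ℚ.+ 1ℚ
      ≡⟨ cong (ℚ._+ 1ℚ) (ℚP.+-identityˡ (aimTotal (a ∷ l))) ⟩
    aimTotal (a ∷ l) ℚ.+ 1ℚ
      ≡⟨ trans ih (cong pos (sym (hole-stays l a≢h))) ⟩
    pos (hole (a ∷ l)) ∎
    where open ≡-Reasoning

  -- Server 0 was used right after the answers l, while a hole other than 0 was left.
  data Early (l : List Label) : List Label → Set where
    turn  : hole l ≢ zero → zero ∉ l → Early l (zero ∷ l)
    later : ∀ {b m} → Early l m → Early l (b ∷ m)

  early-∈ : ∀ {l m} → Early l m → zero ∈ m
  early-∈ (turn _ _) = here refl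
  early-∈ (later e)  = there (early-∈ e)

  early-hole : ∀ {l m} → Early l m → hole l ≢ zero
  early-hole (turn h≢0 _) = h≢0
  early-hole (later e)    = early-hole e

  -- The answer right after server 0 is a right-hand server that was still free at the turn, so the
  -- hole left there is not 0.
  find-early : ∀ {b} m → Unique (b ∷ m) → zero ∈ m → ∃[ l ] Early l m
  find-early {zero} m u z∈ = contradiction z∈ (unique-head u)
  find-early {suc i} (zero ∷ m) u@(_ ∷ u′) (here refl) = m ,
    turn (λ h≡0 → unique-head u (there (hole-zero m h≡0 i))) (unique-head u′)
  find-early (a ∷ m) (_ ∷ u) (there z∈) with find-early m u z∈
  ... | l , e = l , later e

  aimTotal-early : ∀ {l m} → Early l m → aimTotal m ℚ.+ 1ℚ ≡ pos (hole l)
  aimTotal-early {l} (turn h≢0 z∉) = aimTotal-before zero l z∉ h≢0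
  aimTotal-early {l} (later {m = m} e) = trans
    (cong (ℚ._+ 1ℚ) (trans
      (cong (ℚ._+ aimTotal m)
        (trans (cong (λ z → dist z (pos (aim m))) (site-after (early-∈ e)))
          (dist-refl (pos (aim m)))))
      (ℚP.+-identityˡ (aimTotal m))))
    (aimTotal-early e)

  -- From the turn on sites and predicted positions coincide, so their sums keep the difference they
  -- had at the turn. That difference is what certifies the predictions as optimal.
  sites-early : ∀ {l m} → Early l m → sites m ℚ.+ pos (hole l) ≡ aims m ℚ.+ 1ℚ
  sites-early {l} (turn h≢0 z∉) = trans
    (cong (ℚ._+ pos (hole l)) (sites-before zero l z∉))
    (trans (solve 2 (λ w h → w :+ con 1ℚ :+ h := w :+ h :+ con 1ℚ) refl
              (positions l) (pos (hole l)))
      (cong (ℚ._+ 1ℚ) (sym (aims-before zero l))))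
  sites-early {l} (later {m = m} e) = trans
    (ℚP.+-assoc (site m) (sites m) (pos (hole l)))
    (trans (cong₂ ℚ._+_ (site-after (early-∈ e)) (sites-early e))
      (sym (ℚP.+-assoc (pos (aim m)) (aims m) 1ℚ)))

  -- Any transport from sites to positions costs at least the sum of positions minus the sum of
  -- sites; from the turn on, the sites are the predicted positions.
  algTotal-early : ∀ {l m} → Early l m → ∀ j → j ≡ zero ⊎ j ∈ l →
    d (toℕ j) ℚ.+ d (toℕ j) ℚ.+ pos (hole l) ℚ.+ positions m
      ℚ.≤ algTotal m ℚ.+ aims m ℚ.+ 1ℚ
  algTotal-early {l} (turn h≢0 z∉) j j∈ = ≤-shift
    (ℚP.+-mono-≤ (reach l z∉ j j∈) (x≤dist+y (site l) 0ℚ))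
    (trans
      (solve 6 (λ y h w A s D →
          y :+ h :+ (con 0ℚ :+ w) :+ (A :+ s :+ con 1ℚ :+ (D :+ con 0ℚ))
          := D :+ A :+ (w :+ h) :+ con 1ℚ :+ (y :+ s)) refl
        y (pos (hole l)) (positions l) (algTotal l) (site l) (dist (site l) 0ℚ))
      (cong (λ z → dist (site l) 0ℚ ℚ.+ algTotal l ℚ.+ z ℚ.+ 1ℚ ℚ.+ (y ℚ.+ site l))
        (sym (aims-before zero l))))
    where y = d (toℕ j) ℚ.+ d (toℕ j)
  algTotal-early {l} (later {b} {m} e) j j∈ = ≤-shift
    (ℚP.+-mono-≤ (algTotal-early e j j∈) (y≤dist+x (site m) (pos b)))
    (trans
      (solve 8 (λ y h p w A q D s →
          y :+ h :+ (p :+ w) :+ (A :+ q :+ con 1ℚ :+ (D :+ s))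
          := D :+ A :+ (s :+ q) :+ con 1ℚ :+ (y :+ h :+ w :+ p)) refl
        y (pos (hole l)) (pos b) (positions m) (algTotal m) (aims m)
        (dist (site m) (pos b)) (site m))
      (cong (λ z → dist (site m) (pos b) ℚ.+ algTotal m ℚ.+ (z ℚ.+ aims m) ℚ.+ 1ℚ
                     ℚ.+ (y ℚ.+ pos (hole l) ℚ.+ positions m ℚ.+ pos b))
        (site-after (early-∈ e))))
    where y = d (toℕ j) ℚ.+ d (toℕ j)

  -- All servers below the hole are used, in particular the one just before it. If the hole is
  -- server 1, its predecessor is the start, encoded by `zero` as in `reach`.
  early-predecessor : ∀ {l} → hole l ≢ zero →
    Σ[ i ∈ Fin n ] (hole l ≡ suc i × (inject₁ i ≡ zero ⊎ inject₁ i ∈ l))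
  early-predecessor {l} h≢0 with hole l | hole-spec l
  ... | _ | final _                = contradiction refl h≢0
  ... | _ | next zero _ _          = zero , refl , inj₁ refl
  ... | _ | next (suc i) _ below   = suc i , refl ,
    inj₂ (below (inject₁ i) (s≤s (ℕP.≤-reflexive (FinP.toℕ-inject₁ i))))

-- Passage to the reals and the adaptive play

≃-reflexive : ∀ {x y} → x ≡ y → x ≃ y
≃-reflexive {x} refl ε 0<ε = 0 , λ m _ → subst (ℚ._< ε) (sym (dist-refl (seq x m))) 0<ε

≤-termwise : ∀ {x y} → (∀ m → seq x m ℚ.≤ seq y m) → x ≤ y
≤-termwise {x} {y} x≤y ε 0<ε = 0 , λ m _ →
  ℚP.≤-trans (x≤y m) (≤-shift (ℚP.<⇒≤ 0<ε)
    (solve 2 (λ y ε → y :+ ε := y :+ ε :+ con 0ℚ) refl (seq y m) ε))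
  where open +-*-Solver

seq-cost : ∀ {k} (I : Instance k) f m →
  seq (cost I f) m ≡ sum (λ t → dist (seq (requests I t) m) (seq (servers I (f t)) m))
seq-cost I f m = go (λ t → ∣ requests I t - servers I (f t) ∣)
  where
  go : ∀ {j} (x : Fin j → ℝ) → seq (foldr _+_ 0ℝ x) m ≡ sum (λ t → seq (x t) m)
  go {zero}  x = refl
  go {suc j} x = cong (seq (x zero) m ℚ.+_) (go (x ∘ suc))

module _ {k} (A : Algorithm k) (s : Fin k → ℝ)
         (site : List (Fin k) → ℝ) (aim : List (Fin k) → Fin k) where

  challenge : (Fin k → Fin k) → Instance k
  challenge w = mkInstance s (site ∘ past w) (aim ∘ past w)

  answers : ℕ → Fin k → Fin k
  answers zero    = id
  answers (suc m) = run (strategy A) (challenge (answers m))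

  answers-stable : ∀ m t → toℕ t ℕ.< m → answers (suc m) t ≡ answers m t
  answers-stable (suc m) t (s≤s t≤m) = respects A
    (λ i → ≃-reflexive {s i} refl)
    (λ j → ≃-reflexive (cong site (agree j)))
    (λ j → cong aim (agree j))
    where
    agree : (j : Fin.Fin′ (suc t)) →
            past (answers (suc m)) (inject! j) ≡ past (answers m) (inject! j)
    agree j = past-cong (inject! j) (λ u u<j → answers-stable m u
      (ℕP.<-≤-trans u<j (ℕP.≤-trans (ℕ.s≤s⁻¹ (FinP.inject!-< j)) t≤m)))

  -- Iterating "play against the requests provoked by the previous answers" fixes one more
  -- answer each time, so after k rounds the answers reproduce themselves.
  adaptive : ∃[ w ] (run (strategy A) (challenge w) ≗ w)
  adaptive = answers k , λ t → answers-stable k t (FinP.toℕ<n t)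

-- The robustness bound `2 d n - 1` for slowly growing `d`

module _ (n : ℕ) (d : ℕ → ℚ) (d-zero : d 0 ≡ 1ℚ)
         (d-mono : ∀ {i j} → i ℕ.≤ j → d i ℚ.≤ d j)
         {q : ℚ} (gap : ∀ i → q ℚ.* (d (suc i) ℚ.- 1ℚ) ℚ.< d i ℚ.+ d i ℚ.+ d (suc i) ℚ.- 1ℚ)
         {c r : ℝ} (c≤q : ∃[ N ] (∀ m → N ℕ.≤ m → seq c m ℚ.≤ q))
         (A : Algorithm (suc n)) (consistent : Consistent c A) (robust : Robust r A) where

  open Adversary n d d-zero d-mono

  private

    w : Label → Label
    w = proj₁ (adaptive A (fromℚ ∘ pos) (fromℚ ∘ site) aim)

    I : Instance (suc n)
    I = challenge A (fromℚ ∘ pos) (fromℚ ∘ site) aim w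

    run-I : run (strategy A) I ≗ w
    run-I = proj₂ (adaptive A (fromℚ ∘ pos) (fromℚ ∘ site) aim)

    w-injective : Injective _≡_ _≡_ w
    w-injective {s} {t} eq = free A I (trans (run-I s) (trans eq (sym (run-I t))))

    w-unique : Unique (whole w)
    w-unique = injective⇒unique w-injective

    ∈-w : ∀ i → i ∈ whole w
    ∈-w i with injective⇒surjective w-injective i
    ... | t , refl = ∈-whole⁺ w t

    price : (Label → Label) → ℚ
    price f = sum (λ t → dist (site (past w t)) (pos (f t)))

    sum-permuted : (M : Permutation′ (suc n)) → sum (pos ∘ (M ⟨$⟩ʳ_)) ≡ sum pos
    sum-permuted M = sym (sum-permute pos M)

    positions-w : positions (whole w) ≡ sum pos
    positions-w = trans (sym (sum-past (λ _ b → pos b) w))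
      (sum-permuted (injective⇒permutation w-injective))

    sites-w : sum (site ∘ past w) ≡ sites (whole w)
    sites-w = sum-past (λ l _ → site l) w

    -- A matching shifts the sum of coordinates from the sites to `sum pos`, and its price bounds
    -- the net shift. With `pos≤` for the opposite direction this certifies as optimal any matching
    -- that moves all requests one way.
    sites≤ : ∀ (M : Permutation′ (suc n)) → sites (whole w) ℚ.≤ price (M ⟨$⟩ʳ_) ℚ.+ sum pos
    sites≤ M = subst₂ ℚ._≤_ sites-w
      (trans (∑-distrib-+ (λ t → dist (site (past w t)) (pos (M ⟨$⟩ʳ t))) (pos ∘ (M ⟨$⟩ʳ_)))
        (cong (price (M ⟨$⟩ʳ_) ℚ.+_) (sum-permuted M)))
      (sum-mono-≤ (λ t → x≤dist+y (site (past w t)) (pos (M ⟨$⟩ʳ t))))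

    pos≤ : ∀ (M : Permutation′ (suc n)) → sum pos ℚ.≤ price (M ⟨$⟩ʳ_) ℚ.+ sites (whole w)
    pos≤ M = subst₂ ℚ._≤_ (sum-permuted M)
      (trans (∑-distrib-+ (λ t → dist (site (past w t)) (pos (M ⟨$⟩ʳ t))) (site ∘ past w))
        (cong (price (M ⟨$⟩ʳ_) ℚ.+_) sites-w))
      (sum-mono-≤ (λ t → y≤dist+x (site (past w t)) (pos (M ⟨$⟩ʳ t))))

    optimal : ∀ M → (∀ M′ → price (M ⟨$⟩ʳ_) ℚ.≤ price (M′ ⟨$⟩ʳ_)) → Optimal I M
    optimal M least M′ = ≤-termwise {cost I (M ⟨$⟩ʳ_)} {cost I (M′ ⟨$⟩ʳ_)} λ m →
      subst₂ ℚ._≤_ (sym (seq-cost I (M ⟨$⟩ʳ_) m)) (sym (seq-cost I (M′ ⟨$⟩ʳ_) m)) (least M′)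

    seq-algCost : ∀ m → seq (algCost A I) m ≡ algTotal (whole w)
    seq-algCost m = trans (seq-cost I (run (strategy A) I) m)
      (trans (sum-cong-≗ (λ t → cong (λ b → dist (site (past w t)) (pos b)) (run-I t)))
        (sum-past (λ l b → dist (site l) (pos b)) w))

    -- Since OPT is 1, robustness bounds the algorithm's cost by `r`, and its walk visits `d n`
    -- before ending at the origin.
    zero-last : ∀ {b l} → whole w ≡ b ∷ l → zero ≡ b →
                fromℚ (d n ℚ.+ d n ℚ.- 1ℚ) ≤ r
    zero-last {_} {l} eq refl ε 0<ε = proj₁ bound , λ m N≤m →
      ℚP.≤-trans alg-large (subst₂ ℚ._≤_
        (trans (seq-algCost m) (cong algTotal eq))
        (cong (ℚ._+ ε) (trans (cong (seq r m ℚ.*_) (trans (seq-cost I (M ⟨$⟩ʳ_) m) price-M))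
          (ℚP.*-identityʳ (seq r m))))
        (proj₂ bound m N≤m))
      where
      open +-*-Solver
      unique : Unique (zero ∷ l)
      unique = subst Unique eq w-unique
      z∉ : zero ∉ l
      z∉ = unique-head unique
      l-unique : Unique l
      l-unique with unique
      ... | _ ∷ u = u
      M : Permutation′ (suc n)
      M = injective⇒permutation {f = home ∘ past w} (unique⇒injective (subst Unique
        (sym (trans (whole-past home w) (cong (trail home) eq)))
        (trail-home-unique {zero} l l-unique z∉)))
      price-M : price (M ⟨$⟩ʳ_) ≡ 1ℚ
      price-M = trans (sum-past (λ l _ → dist (site l) (pos (home l))) w)
        (trans (cong homeTotal eq) (homeTotal-before zero l z∉))
      M-optimal : Optimal I M
      -- Apart from the first request at 1 and server 0 at 0, sites and answers have the same
      -- positions, so the net shift is exactly 1.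
      M-optimal = optimal M λ M′ → ≤-shift (sites≤ M′) (trans
        (cong₂ ℚ._+_ price-M (cong (price (M′ ⟨$⟩ʳ_) ℚ.+_)
          (trans (sym positions-w) (cong positions eq))))
        (trans (solve 2 (λ p w → con 1ℚ :+ (p :+ (con 0ℚ :+ w)) := p :+ (w :+ con 1ℚ)) refl
                 (price (M′ ⟨$⟩ʳ_)) (positions l))
          (cong (price (M′ ⟨$⟩ʳ_) ℚ.+_)
            (sym (trans (cong sites eq) (sites-before zero l z∉))))))
      v : ℝ
      v = cost I (M ⟨$⟩ʳ_)
      bound : ∃[ N ] (∀ m → N ℕ.≤ m → seq (algCost A I) m ℚ.≤ seq (r * v) m ℚ.+ ε)
      bound = robust I v (M , M-optimal , ≃-reflexive {v} refl) ε 0<ε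
      -- For `n = 0` the farthest label is `zero`, and `reach` uses the start `d 0` instead.
      farthest : Fin.fromℕ n ≡ zero ⊎ Fin.fromℕ n ∈ l
      farthest with subst (Fin.fromℕ n ∈_) eq (∈-w (Fin.fromℕ n))
      ... | here eq  = inj₁ eq
      ... | there ∈l = inj₂ ∈l
      alg-large : d n ℚ.+ d n ℚ.- 1ℚ ℚ.≤ algTotal (zero ∷ l)
      alg-large = ≤-shift
        (ℚP.+-mono-≤
          (subst (λ i → d i ℚ.+ d i ℚ.≤ algTotal l ℚ.+ site l ℚ.+ 1ℚ) (FinP.toℕ-fromℕ n)
            (reach l z∉ (Fin.fromℕ n) farthest))
          (x≤dist+y (site l) 0ℚ))
        (solve 4 (λ y A s D → y :- con 1ℚ :+ (A :+ s :+ con 1ℚ :+ (D :+ con 0ℚ))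
                           := D :+ A :+ (y :+ s)) refl
          (d n ℚ.+ d n) (algTotal l) (site l) (dist (site l) 0ℚ))

    -- Such a play contradicts consistency: its predictions are perfect, and by `gap` the algorithm
    -- pays more than `q` times the optimum.
    zero-early : ∀ {b l m} → whole w ≡ b ∷ m → Early l (b ∷ m) →
                 fromℚ (d n ℚ.+ d n ℚ.- 1ℚ) ≤ r
    zero-early {b} {l} {m} eq early
      with early-predecessor {l} (early-hole early)
    ... | i , h≡suc , visited = contradiction
      (ℚP.≤-<-trans (ℚP.≤-trans alg-large alg-small) (gap (toℕ i)))
      (ℚP.<-irrefl refl)
      where
      open +-*-Solver
      V : ℚ
      V = d (suc (toℕ i)) ℚ.- 1ℚ
      M : Permutation′ (suc n)
      M = injective⇒permutation {f = aim ∘ past w} (unique⇒injective (subst Unique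
        (sym (trans (whole-past aim w) (cong (trail aim) eq)))
        (trail-aim-unique {b} m (subst Unique eq w-unique))))
      price+1 : price (M ⟨$⟩ʳ_) ℚ.+ 1ℚ ≡ pos (hole l)
      price+1 = trans
        (cong (ℚ._+ 1ℚ) (trans (sum-past (λ l _ → dist (site l) (pos (aim l))) w) (cong aimTotal eq)))
        (aimTotal-early early)
      price-M : price (M ⟨$⟩ʳ_) ≡ V
      price-M = trans
        (solve 1 (λ p → p := p :+ con 1ℚ :- con 1ℚ) refl (price (M ⟨$⟩ʳ_)))
        (cong (ℚ._- 1ℚ) (trans price+1 (cong pos h≡suc)))
      aims-w : aims (b ∷ m) ≡ sum pos
      aims-w = trans (cong aims (sym eq))
        (trans (sym (sum-past (λ l _ → pos (aim l)) w)) (sum-permuted M))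
      M-optimal : Optimal I M
      -- By `sites-early` the net shift from sites to servers is `pos (hole l) - 1`, which is the
      -- price of `M`.
      M-optimal = optimal M λ M′ → ≤-shift (pos≤ M′) (trans
        (solve 3 (λ p p′ s → p :+ (p′ :+ s) := p′ :+ (s :+ (p :+ con 1ℚ) :- con 1ℚ)) refl
          (price (M ⟨$⟩ʳ_)) (price (M′ ⟨$⟩ʳ_)) (sites (whole w)))
        (cong (price (M′ ⟨$⟩ʳ_) ℚ.+_) (trans
          (cong (ℚ._- 1ℚ) (trans (cong₂ ℚ._+_ (cong sites eq) price+1)
            (trans (sites-early early) (cong (ℚ._+ 1ℚ) aims-w))))
          (solve 1 (λ s → s :+ con 1ℚ :- con 1ℚ := s) refl (sum pos)))))
      v : ℝ
      v = cost I (M ⟨$⟩ʳ_)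
      0≤V : 0ℚ ℚ.≤ V
      0≤V = ≤-shift (1≤d (suc (toℕ i)))
        (solve 1 (λ x → con 0ℚ :+ x := x :- con 1ℚ :+ con 1ℚ) refl (d (suc (toℕ i))))
      alg-small : algTotal (b ∷ m) ℚ.≤ q ℚ.* V
      -- The costs are constant sequences, so one late index `K` suffices, where `seq c K` is at
      -- most `q`.
      alg-small = ≤-limit λ ε 0<ε →
        let N , c≤  = c≤q
            N′ , h  = consistent I (M , M-optimal , λ t → refl) v
                        (M , M-optimal , ≃-reflexive {v} refl) ε 0<ε
            K       = N ℕ.⊔ N′
        in ℚP.≤-trans
          (subst₂ ℚ._≤_ (trans (seq-algCost K) (cong algTotal eq))
            (cong (λ z → seq c K ℚ.* z ℚ.+ ε) (trans (seq-cost I (M ⟨$⟩ʳ_) K) price-M))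
            (h K (ℕP.m≤n⊔m N N′)))
          (ℚP.+-monoˡ-≤ ε (ℚP.*-monoʳ-≤-nonNeg V {{ℚ.nonNegative 0≤V}}
            (c≤ K (ℕP.m≤m⊔n N N′))))
      p : ℚ
      p = d (toℕ i)
      alg-large : p ℚ.+ p ℚ.+ d (suc (toℕ i)) ℚ.- 1ℚ ℚ.≤ algTotal (b ∷ m)
      -- Answers and predictions both exhaust the servers, so `positions` and `aims` have equal
      -- totals and cancel in `algTotal-early`.
      alg-large = ≤-shift
        (subst₂ (λ j h → d j ℚ.+ d j ℚ.+ pos h ℚ.+ positions (b ∷ m)
                   ℚ.≤ algTotal (b ∷ m) ℚ.+ aims (b ∷ m) ℚ.+ 1ℚ)
          (FinP.toℕ-inject₁ i) h≡suc
          (algTotal-early early (inject₁ i) visited))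
        (trans
          (solve 4 (λ p u A q → p :+ p :+ u :- con 1ℚ :+ (A :+ q :+ con 1ℚ)
                             := A :+ (p :+ p :+ u :+ q)) refl
            p (d (suc (toℕ i))) (algTotal (b ∷ m)) (aims (b ∷ m)))
          (cong (λ z → algTotal (b ∷ m) ℚ.+ (p ℚ.+ p ℚ.+ d (suc (toℕ i)) ℚ.+ z))
            (trans aims-w (trans (sym positions-w) (cong positions eq)))))

  robustness-bound : fromℚ (d n ℚ.+ d n ℚ.- 1ℚ) ≤ r
  robustness-bound with ∈-w zero
  ... | here eq  = zero-last refl eq
  ... | there z∈ = zero-early refl (later {b = w (Fin.fromℕ n)}
    (proj₂ (find-early {w (Fin.fromℕ n)} (whole (w ∘ inject₁)) w-unique z∈)))

-- Geometric and nearly arithmetic server positions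

0≤* : ∀ {x y} → 0ℚ ℚ.≤ x → 0ℚ ℚ.≤ y → 0ℚ ℚ.≤ x ℚ.* y
0≤* {x} {y} 0≤x 0≤y = subst (ℚ._≤ x ℚ.* y) (ℚP.*-zeroʳ x)
  (ℚP.*-monoˡ-≤-nonNeg x {{ℚ.nonNegative 0≤x}} 0≤y)

0<½ : 0ℚ ℚ.< ½
0<½ = ℚP.positive⁻¹ ½

0<½* : ∀ {x} → 0ℚ ℚ.< x → 0ℚ ℚ.< ½ ℚ.* x
0<½* = ℚP.*-monoʳ-<-pos ½

small : ∀ {ε} → 0ℚ ℚ.< ε → Σ[ δ ∈ ℚ ] (0ℚ ℚ.< δ × δ ℚ.≤ 1ℚ × δ ℚ.≤ ε)
small {ε} 0<ε with ℚP.≤-total ε 1ℚ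
... | inj₁ ε≤1 = ε , 0<ε , ε≤1 , ℚP.≤-refl
... | inj₂ 1≤ε = 1ℚ , ℚP.positive⁻¹ 1ℚ , ℚP.≤-refl , 1≤ε

frac : ℕ → ℚ
frac i = ℤ.+ i ℚ./ 1

frac-suc : ∀ i → frac (suc i) ≡ frac i ℚ.+ 1ℚ
frac-suc i = ℚP.toℚᵘ-injective (begin
  ℚ.toℚᵘ (frac (suc i))                ≈⟨ ℚP.toℚᵘ-fromℚᵘ (ℚᵘ.mkℚᵘ (ℤ.+ suc i) 0) ⟩
  ℚᵘ.mkℚᵘ (ℤ.+ suc i) 0                ≈⟨ ℚᵘ.*≡* (cong (ℤ._* ℤ.+ 1) numerator) ⟩
  ℚᵘ.mkℚᵘ (ℤ.+ i) 0 ℚᵘ.+ ℚᵘ.1ℚᵘ        ≈⟨ ℚᵘP.+-congˡ ℚᵘ.1ℚᵘ (ℚP.toℚᵘ-fromℚᵘ (ℚᵘ.mkℚᵘ (ℤ.+ i) 0)) ⟨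
  ℚ.toℚᵘ (frac i) ℚᵘ.+ ℚ.toℚᵘ 1ℚ       ≈⟨ ℚP.toℚᵘ-homo-+ (frac i) 1ℚ ⟨
  ℚ.toℚᵘ (frac i ℚ.+ 1ℚ)               ∎)
  where
  open ℚᵘP.≃-Reasoning
  numerator : ℤ.+ suc i ≡ ℤ.+ i ℤ.* ℤ.+ 1 ℤ.+ ℤ.+ 1
  numerator = trans (cong ℤ.+_ (ℕP.+-comm 1 i))
    (cong (ℤ._+ ℤ.+ 1) (sym (ℤP.*-identityʳ (ℤ.+ i))))

module Geometric {ε : ℚ} (0<ε : 0ℚ ℚ.< ε) (ε≤1 : ε ℚ.≤ 1ℚ) where

  open +-*-Solver

  β : ℚ
  β = 1ℚ ℚ.+ ½ ℚ.* ε

  power : ℕ → ℚ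
  power zero    = 1ℚ
  power (suc i) = β ℚ.* power i

  seq-^ : ∀ k m → seq (fromℚ β ^ k) m ≡ power k
  seq-^ zero    m = refl
  seq-^ (suc k) m = cong (β ℚ.*_) (seq-^ k m)

  0≤ε : 0ℚ ℚ.≤ ε
  0≤ε = ℚP.<⇒≤ 0<ε

  0≤1-ε : 0ℚ ℚ.≤ 1ℚ ℚ.- ε
  0≤1-ε = ≤-shift ε≤1 (solve 1 (λ e → con 0ℚ :+ con 1ℚ := con 1ℚ :- e :+ e) refl ε)

  power-step : ∀ {x} → 0ℚ ℚ.≤ x → x ℚ.≤ β ℚ.* x
  power-step {x} 0≤x = ≤-shift (0≤* (ℚP.<⇒≤ (0<½* 0<ε)) 0≤x)
    (solve 2 (λ e x → x :+ con ½ :* e :* x := (con 1ℚ :+ con ½ :* e) :* x :+ con 0ℚ) refl ε x)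

  1≤power : ∀ i → 1ℚ ℚ.≤ power i

  0≤power : ∀ i → 0ℚ ℚ.≤ power i
  0≤power i = ℚP.≤-trans (ℚP.<⇒≤ (ℚP.positive⁻¹ 1ℚ)) (1≤power i)

  1≤power zero    = ℚP.≤-refl
  1≤power (suc i) = ℚP.≤-trans (1≤power i) (power-step (0≤power i))

  -- The base satisfies `(3 - ε) β = 2 + β - ε² / 2`, which leaves slack `ε² / 2` times `power i`;
  -- the constants contribute `1 + (1 - ε)` and the strictness.
  power-gap : ∀ i → (frac 3 ℚ.- ε) ℚ.* (power (suc i) ℚ.- 1ℚ)
                      ℚ.< power i ℚ.+ power i ℚ.+ power (suc i) ℚ.- 1ℚ
  power-gap i = <-shift
    (ℚP.+-mono-<-≤ (ℚP.positive⁻¹ 1ℚ)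
      (ℚP.+-mono-≤ 0≤1-ε (0≤* (ℚP.<⇒≤ 0<½) (0≤* 0≤ε (0≤* 0≤ε (0≤power i))))))
    (solve 2 (λ e p →
        (con (frac 3) :- e) :* ((con 1ℚ :+ con ½ :* e) :* p :- con 1ℚ)
          :+ (con 1ℚ :+ (con 1ℚ :- e :+ con ½ :* (e :* (e :* p))))
        := p :+ p :+ (con 1ℚ :+ con ½ :* e) :* p :- con 1ℚ :+ con 0ℚ) refl
      ε (power i))

  -- The bound with index `n` is for `n + 1` servers. The factor `½` absorbs the extra `β`, at most
  -- 3/2, and `power i` is at least 1.
  half-power : ∀ i → ½ ℚ.* power (suc i) ℚ.≤ power i ℚ.+ power i ℚ.- 1ℚ
  half-power i = ≤-shift
    (ℚP.+-mono-≤ (1≤power i)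
      (ℚP.+-mono-≤ (0≤* (ℚP.<⇒≤ 0<½) (0≤* (ℚP.<⇒≤ 0<½) (0≤power i)))
        (0≤* (ℚP.<⇒≤ 0<½) (0≤* (ℚP.<⇒≤ 0<½) (0≤* 0≤1-ε (0≤power i))))))
    (solve 2 (λ e p →
        con ½ :* ((con 1ℚ :+ con ½ :* e) :* p)
          :+ (p :+ (con ½ :* (con ½ :* p) :+ con ½ :* (con ½ :* ((con 1ℚ :- e) :* p))))
        := p :+ p :- con 1ℚ :+ (con 1ℚ :+ (con 0ℚ :+ con 0ℚ))) refl
      ε (power i))

module Arithmetic {δ : ℚ} (0<δ : 0ℚ ℚ.< δ) (δ≤1 : δ ℚ.≤ 1ℚ) where

  open +-*-Solver

  slack : ℕ → ℚ
  slack zero    = δ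
  slack (suc i) = ½ ℚ.* slack i

  -- The increments are `1 - slack (suc i)`, strictly below 1 because `gap` with factor 3 amounts to
  -- `d (suc i) - d i < 1`. Halving keeps the total loss below `δ` for any number of servers.
  position : ℕ → ℚ
  position i = frac (suc i) ℚ.- δ ℚ.+ slack i

  0<slack : ∀ i → 0ℚ ℚ.< slack i
  0<slack zero    = 0<δ
  0<slack (suc i) = 0<½* (0<slack i)

  slack≤1 : ∀ i → slack i ℚ.≤ 1ℚ
  slack≤1 zero    = δ≤1
  slack≤1 (suc i) = ℚP.≤-trans (ℚP.*-monoˡ-≤-nonNeg ½ (slack≤1 i))
    (ℚP.<⇒≤ (ℚ.*<* (ℤ.+<+ (s≤s (s≤s z≤n)))))

  position-zero : position 0 ≡ 1ℚ
  position-zero = solve 1 (λ δ → con 1ℚ :- δ :+ δ := con 1ℚ) refl δ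

  position-step : ∀ i → position i ℚ.≤ position (suc i)
  position-step i = ≤-shift
    (ℚP.+-mono-≤ (slack≤1 (suc i)) (ℚP.≤-refl {slack i}))
    (trans
      (solve 3 (λ c δ s → c :- δ :+ s :+ (con 1ℚ :+ s)
                       := c :+ con 1ℚ :- δ :+ con ½ :* s :+ (con ½ :* s :+ s)) refl
        (frac (suc i)) δ (slack i))
      (cong (λ z → z ℚ.- δ ℚ.+ slack (suc i) ℚ.+ (slack (suc i) ℚ.+ slack i))
        (sym (frac-suc (suc i)))))

  position-gap : ∀ i → frac 3 ℚ.* (position (suc i) ℚ.- 1ℚ)
                         ℚ.< position i ℚ.+ position i ℚ.+ position (suc i) ℚ.- 1ℚ
  position-gap i = <-shift (0<slack i)
    (subst
      (λ z → frac 3 ℚ.* (z ℚ.- δ ℚ.+ slack (suc i) ℚ.- 1ℚ) ℚ.+ slack i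
           ≡ position i ℚ.+ position i ℚ.+ (z ℚ.- δ ℚ.+ slack (suc i)) ℚ.- 1ℚ ℚ.+ 0ℚ)
      (sym (frac-suc (suc i)))
      (solve 3 (λ c δ s →
          con (frac 3) :* (c :+ con 1ℚ :- δ :+ con ½ :* s :- con 1ℚ) :+ s
          := (c :- δ :+ s) :+ (c :- δ :+ s) :+ (c :+ con 1ℚ :- δ :+ con ½ :* s) :- con 1ℚ
             :+ con 0ℚ) refl
        (frac (suc i)) δ (slack i)))

  position-large : ∀ i → frac 2 ℚ.* frac (suc i) ℚ.- 1ℚ
                           ℚ.≤ position i ℚ.+ position i ℚ.- 1ℚ ℚ.+ (δ ℚ.+ δ)
  position-large i = ≤-shift
    (ℚP.+-mono-≤ (ℚP.<⇒≤ (0<slack i)) (ℚP.<⇒≤ (0<slack i)))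
    (solve 3 (λ c δ s →
        con (frac 2) :* c :- con 1ℚ :+ (s :+ s)
        := (c :- δ :+ s) :+ (c :- δ :+ s) :- con 1ℚ :+ (δ :+ δ) :+ (con 0ℚ :+ con 0ℚ)) refl
      (frac (suc i)) δ (slack i))

-- Exponential growth below 3 and the linear bound at 3

exponential : ∀ c → c < fromℕ 3 → GrowsExponentially (Robustness c)
exponential c (ε₀ , 0<ε₀ , N , c<3) =
  fromℚ ½ , fromℚ β ,
  (½ , 0<½ , 0 , λ _ _ → ℚP.≤-refl) ,
  (½ ℚ.* ε , 0<½* 0<ε , 0 , λ _ _ → ℚP.≤-refl) ,
  bound
  where
  open +-*-Solver
  -- The distance from `c` to 3 is capped at 1 for `Geometric`. The rate `β` thus depends on `c` but
  -- not on the number of servers.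
  ε : ℚ
  ε = proj₁ (small 0<ε₀)
  0<ε : 0ℚ ℚ.< ε
  0<ε = proj₁ (proj₂ (small 0<ε₀))
  open Geometric 0<ε (proj₁ (proj₂ (proj₂ (small 0<ε₀))))
  c≤q : ∀ m → N ℕ.≤ m → seq c m ℚ.≤ frac 3 ℚ.- ε
  c≤q m N≤m = ≤-shift
    (ℚP.≤-trans (ℚP.+-monoʳ-≤ (seq c m) (proj₂ (proj₂ (proj₂ (small 0<ε₀))))) (c<3 m N≤m))
    (solve 2 (λ c e → c :+ con (frac 3) := con (frac 3) :- e :+ (c :+ e)) refl (seq c m) ε)
  bound : ∀ k → 1 ℕ.≤ k → fromℚ ½ * fromℚ β ^ k ≤inf Robustness c k
  bound (suc n) _ r (A , consistent , robust) η 0<η =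
    let M , h = robustness-bound n power refl (monotone (λ i → power-step (0≤power i)))
                  power-gap {c} {r} (N , c≤q) A consistent robust η 0<η
    in M , λ m M≤m → ℚP.≤-trans
         (ℚP.≤-reflexive (cong (½ ℚ.*_) (seq-^ (suc n) m)))
         (ℚP.≤-trans (half-power n) (h m M≤m))

endpoint : ∀ k → 1 ℕ.≤ k → fromℕ 2 * fromℕ k - 1ℝ ≤inf Robustness (fromℕ 3) k
endpoint (suc n) _ r (A , consistent , robust) ε 0<ε =
  let M , h = robustness-bound n position position-zero (monotone position-step)
                position-gap {fromℕ 3} {r} (0 , λ _ _ → ℚP.≤-refl) A consistent robust
                (½ ℚ.* ε) (0<½* 0<ε)
  in M , λ m M≤m → ℚP.≤-trans (position-large n)
       (≤-shift
         (ℚP.+-mono-≤ (h m M≤m) (ℚP.+-mono-≤ δ≤ δ≤))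
         (solve 4 (λ p δ r e →
             p :+ (δ :+ δ) :+ (r :+ con ½ :* e :+ (con ½ :* (con ½ :* e) :+ con ½ :* (con ½ :* e)))
             := r :+ e :+ (p :+ (δ :+ δ))) refl
           (position n ℚ.+ position n ℚ.- 1ℚ) δ (seq r m) ε))
  where
  open +-*-Solver
  -- The loss `2 δ` in `position-large` is at most `ε / 2` when `δ` is at most `ε / 4`;
  -- `robustness-bound` uses the other half. Each tolerance thus has its own server placement.
  tiny = small (0<½* (0<½* 0<ε))
  δ : ℚ
  δ = proj₁ tiny
  open Arithmetic (proj₁ (proj₂ tiny)) (proj₁ (proj₂ (proj₂ tiny)))
  δ≤ : δ ℚ.≤ ½ ℚ.* (½ ℚ.* ε)
  δ≤ = proj₂ (proj₂ (proj₂ tiny))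

corollary16 : (∀ (c : ℝ) → 1ℝ ≤ c → c < fromℕ 3 → GrowsExponentially (Robustness c))
    × (∀ (k : ℕ) → 1 ℕ.≤ k →
    fromℕ 2 * fromℕ k - 1ℝ ≤inf Robustness (fromℕ 3) k)
corollary16 = (λ c _ → exponential c) , endpoint
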